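{- For every natural complete nFe-sequence $(\omega_n)_{n\ge 1}$ there exists at least one complex complete nFe-sequence $\tilde\omega:\mathbb{C}\to\mathbb{C}$ whose corresponding natural complete nFe-sequence is $(\omega_n)_{n\ge1}$. Furthermore, for every complex complete nFe-sequence there exists exactly one corresponding natural complete nFe-sequence.
   Context: A sequence $(\omega_n)_{n\ge1}$ of complex numbers, with initial values $\omega_1,\omega_2\in\mathbb{C}$ chosen arbitrarily, is called a natural complete nFe-sequence (negaFibonacci-esque sequence) if $\omega_n=\omega_{n-2}-\omega_{n-1}$ for all natural numbers $n\ge3$. A function $\tilde\omega:\mathbb{C}\to\mathbb{C}$ is called a complex complete nFe-sequence if $\tilde\omega(n)=\tilde\omega(n-2)-\tilde\omega(n-1)$ for all $n\in\mathbb{C}$. A natural complete nFe-sequence $(\omega_n)_{n\ge1}$ is called the corresponding natural complete nFe-sequence of a complex complete nFe-sequence $\tilde\omega$ if $\tilde\omega(n)=\omega_n$ for all natural numbers $n\geq 1$. -}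

module Defs where

open import Data.Integer.Base using (+_)
open import Data.Nat.Base as ℕ using (ℕ; NonZero)
import Data.Nat.Properties as ℕ
open import Data.Product using (∃; _×_; _,_)
open import Data.Rational.Base as ℚ using (ℚ; 0ℚ; ½; ∣_∣)
import Data.Rational.Properties as ℚ
open import Data.Rational.Solver using (module +-*-Solver)
open import Function.Bundles using (_⟶ₛ_; Func)
open import Level using (0ℓ)
open import Relation.Binary.Bundles using (Setoid)
open import Relation.Binary.PropositionalEquality
  using (_≡_; refl; sym; trans; cong; subst)

open +-*-Solver using (solve; _:+_; _:-_; :-_; _:=_)

------------------------------------------------------------------------
-- Real numbers: Cauchy sequences of rationals modulo null sequences.
-- The quotient is represented by the setoid equality _≈ᴿ_.

IsCauchy : (ℕ → ℚ) → Set
IsCauchy s = ∀ ε → 0ℚ ℚ.< ε →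
  ∃ λ N → ∀ m n → N ℕ.≤ m → N ℕ.≤ n → ∣ s m ℚ.- s n ∣ ℚ.< ε

record ℝ : Set where
  constructor mkℝ
  field
    seq    : ℕ → ℚ
    cauchy : IsCauchy seq

open ℝ public

infix 4 _≈ᴿ_ _≈_ _≐_
infixl 6 _+ᴿ_ _-ᴿ_ _+_ _-_
infix 8 -ᴿ_ -_

_≈ᴿ_ : ℝ → ℝ → Set
x ≈ᴿ y = ∀ ε → 0ℚ ℚ.< ε →
  ∃ λ N → ∀ n → N ℕ.≤ n → ∣ seq x n ℚ.- seq y n ∣ ℚ.< ε

private
  half : ∀ ε → 0ℚ ℚ.< ε → ∃ λ δ → 0ℚ ℚ.< δ × δ ℚ.+ δ ≡ ε
  half ε 0<ε = ½ ℚ.* ε , ℚ.*-monoʳ-<-pos ½ 0<ε ,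
    trans (sym (ℚ.*-distribʳ-+ ε ½ ½)) (ℚ.*-identityˡ ε)

  ∣p-q∣≡∣q-p∣ : ∀ p q → ∣ p ℚ.- q ∣ ≡ ∣ q ℚ.- p ∣
  ∣p-q∣≡∣q-p∣ p q = trans
    (cong ∣_∣ (solve 2 (λ p q → p :- q := :- (q :- p)) refl p q))
    (ℚ.∣-p∣≡∣p∣ (q ℚ.- p))

  ∣p-p∣< : ∀ p {ε} → 0ℚ ℚ.< ε → ∣ p ℚ.- p ∣ ℚ.< ε
  ∣p-p∣< p 0<ε = subst (ℚ._< _) (sym (cong ∣_∣ (ℚ.+-inverseʳ p))) 0<ε

  ∣+∣< : ∀ {p q r δ ε} → p ℚ.+ q ≡ r → δ ℚ.+ δ ≡ ε →
         ∣ p ∣ ℚ.< δ → ∣ q ∣ ℚ.< δ → ∣ r ∣ ℚ.< ε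
  ∣+∣< {p} {q} refl refl p<δ q<δ =
    ℚ.≤-<-trans (ℚ.∣p+q∣≤∣p∣+∣q∣ p q) (ℚ.+-mono-< p<δ q<δ)

≈ᴿ-refl : ∀ {x} → x ≈ᴿ x
≈ᴿ-refl {x} ε 0<ε = 0 , λ n _ → ∣p-p∣< (seq x n) 0<ε

≈ᴿ-sym : ∀ {x y} → x ≈ᴿ y → y ≈ᴿ x
≈ᴿ-sym {x} {y} x≈y ε 0<ε with x≈y ε 0<ε
... | N , close = N , λ n N≤n →
  subst (ℚ._< ε) (∣p-q∣≡∣q-p∣ (seq x n) (seq y n)) (close n N≤n)

≈ᴿ-trans : ∀ {x y z} → x ≈ᴿ y → y ≈ᴿ z → x ≈ᴿ z
≈ᴿ-trans {x} {y} {z} x≈y y≈z ε 0<ε with half ε 0<ε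
... | δ , 0<δ , δ+δ≡ε with x≈y δ 0<δ | y≈z δ 0<δ
... | M , closeM | N , closeN = M ℕ.⊔ N , λ n M⊔N≤n →
  ∣+∣< (solve 3 (λ a b c → (a :- b) :+ (b :- c) := a :- c) refl
          (seq x n) (seq y n) (seq z n))
       δ+δ≡ε
       (closeM n (ℕ.m⊔n≤o⇒m≤o M N M⊔N≤n))
       (closeN n (ℕ.m⊔n≤o⇒n≤o M N M⊔N≤n))

fromℚᴿ : ℚ → ℝ
fromℚᴿ q = mkℝ (λ _ → q) λ ε 0<ε → 0 , λ _ _ _ _ → ∣p-p∣< q 0<ε

_+ᴿ_ : ℝ → ℝ → ℝ
x +ᴿ y = mkℝ (λ n → seq x n ℚ.+ seq y n) isCauchy
  where
  isCauchy : IsCauchy (λ n → seq x n ℚ.+ seq y n)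
  isCauchy ε 0<ε with half ε 0<ε
  ... | δ , 0<δ , δ+δ≡ε with cauchy x δ 0<δ | cauchy y δ 0<δ
  ... | M , closeM | N , closeN = M ℕ.⊔ N , λ m n ≤m ≤n →
    ∣+∣< (solve 4 (λ a b c d → (a :- b) :+ (c :- d) := (a :+ c) :- (b :+ d)) refl
            (seq x m) (seq x n) (seq y m) (seq y n))
         δ+δ≡ε
         (closeM m n (ℕ.m⊔n≤o⇒m≤o M N ≤m) (ℕ.m⊔n≤o⇒m≤o M N ≤n))
         (closeN m n (ℕ.m⊔n≤o⇒n≤o M N ≤m) (ℕ.m⊔n≤o⇒n≤o M N ≤n))

-ᴿ_ : ℝ → ℝ
-ᴿ x = mkℝ (λ n → ℚ.- seq x n) isCauchy
  where
  isCauchy : IsCauchy (λ n → ℚ.- seq x n)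
  isCauchy ε 0<ε with cauchy x ε 0<ε
  ... | N , close = N , λ m n ≤m ≤n → subst (ℚ._< ε)
    (cong ∣_∣ (solve 2 (λ a b → b :- a := (:- a) :- (:- b)) refl (seq x m) (seq x n)))
    (close n m ≤n ≤m)

_-ᴿ_ : ℝ → ℝ → ℝ
x -ᴿ y = x +ᴿ -ᴿ y

------------------------------------------------------------------------
-- Complex numbers. Only the additive structure and the embedding of ℕ
-- occur in the recurrences, so multiplication is not developed.

record ℂ : Set where
  constructor _+i_
  field
    re im : ℝ

open ℂ public

_≈_ : ℂ → ℂ → Set
w ≈ z = re w ≈ᴿ re z × im w ≈ᴿ im z

_+_ : ℂ → ℂ → ℂ
w + z = (re w +ᴿ re z) +i (im w +ᴿ im z)

-_ : ℂ → ℂ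
- z = (-ᴿ re z) +i (-ᴿ im z)

_-_ : ℂ → ℂ → ℂ
w - z = w + - z

fromℕ : ℕ → ℂ
fromℕ n = fromℚᴿ (+ n ℚ./ 1) +i fromℚᴿ 0ℚ

-- The implicit real arguments are spelled out because _≈ᴿ_ unfolds and
-- does not determine them.
ℂ-setoid : Setoid 0ℓ 0ℓ
ℂ-setoid = record
  { Carrier       = ℂ
  ; _≈_           = _≈_
  ; isEquivalence = record
    { refl  = λ {w} → ≈ᴿ-refl {re w} , ≈ᴿ-refl {im w}
    ; sym   = λ {w} {z} (p , q) →
        ≈ᴿ-sym {re w} {re z} p , ≈ᴿ-sym {im w} {im z} q
    ; trans = λ {v} {w} {z} (p , q) (p′ , q′) →
        ≈ᴿ-trans {re v} {re w} {re z} p p′ , ≈ᴿ-trans {im v} {im w} {im z} q q′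
    }
  }

------------------------------------------------------------------------
-- NegaFibonacci-esque sequences

NatSequence : Set
NatSequence = (n : ℕ) .{{_ : NonZero n}} → ℂ

_≐_ : NatSequence → NatSequence → Set
ω ≐ ω′ = (n : ℕ) .{{_ : NonZero n}} → ω n ≈ ω′ n

-- A function ℂ → ℂ has to respect the equality of complex numbers, hence a
-- setoid map.
ComplexFunction : Set
ComplexFunction = ℂ-setoid ⟶ₛ ℂ-setoid

open Func public using () renaming (to to infixl 9 _⟨$⟩_)

-- The indices n ≥ 3 are written as 3 + n with n ranging over ℕ.
IsNaturalCompleteNFe : NatSequence → Set
IsNaturalCompleteNFe ω = ∀ n →
  ω (3 ℕ.+ n) ≈ ω (1 ℕ.+ n) - ω (2 ℕ.+ n)

IsComplexCompleteNFe : ComplexFunction → Set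
IsComplexCompleteNFe ω̃ = ∀ z →
  ω̃ ⟨$⟩ z ≈ ω̃ ⟨$⟩ (z - fromℕ 2) - ω̃ ⟨$⟩ (z - fromℕ 1)

-- "ω is a corresponding natural complete nFe-sequence of ω̃."
IsCorrespondingNFe : NatSequence → ComplexFunction → Set
IsCorrespondingNFe ω ω̃ =
  IsNaturalCompleteNFe ω ×
  ((n : ℕ) .{{_ : NonZero n}} → ω̃ ⟨$⟩ fromℕ n ≈ ω n)

{-# OPTIONS --safe #-}

-- Extending ω by 0 off the integers is not available constructively, because
-- being an integer is undecidable for a Cauchy real. Instead the recurrence is
-- run backwards to all of ℤ and interpolated linearly between consecutive
-- integers: the recurrence is linear and shift-invariant, so it holds for the
-- interpolation too. With e the two-sided solution having e 0 = 0 and e 1 = 1,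
-- ω (k) = e (k - 2) ω 1 + e (k - 1) ω 2, and the extension replaces e by its
-- interpolation at the real part of the argument. On rationals the interpolation
-- is decided by the floor and is locally Lipschitz, hence acts on Cauchy sequences.
module Submission where

open import Defs
open import Data.Product using (∃; ∃!; _×_)

open import Data.Integer.Base as ℤ using (ℤ; +_; -[1+_])
import Data.Integer.DivMod as ℤ
import Data.Integer.Properties as ℤ
open import Data.Nat.Base as ℕ using (ℕ; zero; suc)
import Data.Nat.Properties as ℕ
open import Data.Product using (_,_; proj₁; proj₂)
open import Data.Rational.Base as ℚ using (ℚ; 0ℚ; 1ℚ; ½; ∣_∣; floor)
open import Data.Rational.Literals using (fromℤ)
import Data.Rational.Properties as ℚ
open import Data.Rational.Solver using (module +-*-Solver)
open import Data.Sum.Base using (_⊎_; inj₁; inj₂)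
open import Function.Bundles using (Func)
open import Relation.Binary.Bundles using (Setoid)
open import Relation.Binary.PropositionalEquality
  using (_≡_; refl; sym; trans; cong; cong₂; subst; subst₂; module ≡-Reasoning)
import Relation.Binary.Reasoning.Setoid as ≈-Reasoning
open import Relation.Nullary using (yes; no)

open +-*-Solver using (solve; con; _:+_; _:*_; _:-_; :-_; _:=_)

private
  2ℚ : ℚ
  2ℚ = fromℤ (+ 2)

-- Integer parts of rational numbers

fromℤ-+ : ∀ i j → fromℤ (i ℤ.+ j) ≡ fromℤ i ℚ.+ fromℤ j
fromℤ-+ i j = trans (sym (ℚ.↥p/↧p≡p (fromℤ (i ℤ.+ j))))
  (cong (ℚ._/ 1) (sym (cong₂ ℤ._+_ (ℤ.*-identityʳ i) (ℤ.*-identityʳ j))))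

fromℤ-cancel-< : ∀ {i j} → fromℤ i ℚ.< fromℤ j → i ℤ.< j
fromℤ-cancel-< {i} {j} (ℚ.*<* i<j) =
  subst₂ ℤ._<_ (ℤ.*-identityʳ i) (ℤ.*-identityʳ j) i<j

i<1+j⇒i≤j : ∀ {i j} → i ℤ.< ℤ.suc j → i ℤ.≤ j
i<1+j⇒i≤j {i} {j} i<1+j =
  subst (i ℤ.≤_) (ℤ.pred-suc j) (ℤ.i<j⇒i≤pred[j] i<1+j)

floor-≤ : ∀ q → fromℤ (floor q) ℚ.≤ q
floor-≤ q@record{} = ℚ.*≤* (subst (floor q ℤ.* ℚ.↧ q ℤ.≤_) (sym (ℤ.*-identityʳ _))
  (ℤ.[n/d]*d≤n (ℚ.↥ q) (ℚ.↧ q)))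

<-suc-floor : ∀ q → q ℚ.< fromℤ (ℤ.suc (floor q))
<-suc-floor q@record{} = ℚ.*<* (subst₂ ℤ._<_ (sym (ℤ.*-identityʳ _))
  (cong (λ i → ℤ.suc i ℤ.* ℚ.↧ q) (sym (ℤ.div-pos-is-/ℕ (ℚ.↥ q) (ℚ.↧ₙ q))))
  (ℤ.n<s[n/ℕd]*d (ℚ.↥ q) (ℚ.↧ₙ q)))

fromℤ≤⇒≤-floor : ∀ {q i} → fromℤ i ℚ.≤ q → i ℤ.≤ floor q
fromℤ≤⇒≤-floor {q} i≤q = i<1+j⇒i≤j (fromℤ-cancel-< (ℚ.≤-<-trans i≤q (<-suc-floor q)))

floor-+1 : ∀ q → floor (q ℚ.+ 1ℚ) ≡ ℤ.suc (floor q)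
floor-+1 q = ℤ.≤-antisym
  (i<1+j⇒i≤j (fromℤ-cancel-< (ℚ.≤-<-trans (floor-≤ (q ℚ.+ 1ℚ))
    (subst (q ℚ.+ 1ℚ ℚ.<_) (eq (ℤ.suc (floor q))) (ℚ.+-monoˡ-< 1ℚ (<-suc-floor q))))))
  (fromℤ≤⇒≤-floor (subst (ℚ._≤ q ℚ.+ 1ℚ) (eq (floor q)) (ℚ.+-monoˡ-≤ 1ℚ (floor-≤ q))))
  where
  eq : ∀ i → fromℤ i ℚ.+ 1ℚ ≡ fromℤ (ℤ.suc i)
  eq i = trans (ℚ.+-comm (fromℤ i) 1ℚ) (sym (fromℤ-+ (+ 1) i))

floor-mono : ∀ {p q} → p ℚ.≤ q → floor p ℤ.≤ floor q
floor-mono {p} p≤q = fromℤ≤⇒≤-floor (ℚ.≤-trans (floor-≤ p) p≤q)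

-- Monotonicity squeezes `floor q` between `floor p` and `floor (p + 1)`. Later estimates thus meet
-- only equal or adjacent pieces.
floor-step : ∀ {p q} → p ℚ.≤ q → q ℚ.≤ p ℚ.+ 1ℚ →
             floor q ≡ floor p ⊎ floor q ≡ ℤ.suc (floor p)
floor-step {p} {q} p≤q q≤p+1 with floor q ℤ.≤? floor p
... | yes ≤p = inj₁ (ℤ.≤-antisym ≤p (floor-mono p≤q))
... | no  ≰p = inj₂ (ℤ.≤-antisym
  (subst (floor q ℤ.≤_) (floor-+1 p) (floor-mono q≤p+1))
  (ℤ.i<j⇒suc[i]≤j (ℤ.≰⇒> ≰p)))

-- The two-sided integer negaFibonacci sequence

alternatingFib : ℕ → ℚ
alternatingFib 0 = 0ℚ
alternatingFib 1 = 1ℚ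
alternatingFib (suc (suc n)) = alternatingFib n ℚ.- alternatingFib (suc n)

fib : ℕ → ℚ
fib 0 = 0ℚ
fib 1 = 1ℚ
fib (suc (suc n)) = fib (suc n) ℚ.+ fib n

-- Run backwards the recurrence adds, so the value at -n is the Fibonacci number F(n); at +n it is
-- F(n) with sign (-1)^(n+1).
negaFib : ℤ → ℚ
negaFib (+ n)    = alternatingFib n
negaFib -[1+ n ] = fib (suc n)

negaFib-rec : ∀ i → negaFib (ℤ.suc (ℤ.suc i)) ≡ negaFib i ℚ.- negaFib (ℤ.suc i)
negaFib-rec (+ n)              = refl
-- At -1 and -2 the three indices straddle zero, and closed terms are compared. Below that, the
-- Fibonacci recurrence is solved for its smaller term.
negaFib-rec -[1+ 0 ]           = refl
negaFib-rec -[1+ 1 ]           = refl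
negaFib-rec -[1+ suc (suc n) ] =
  solve 2 (λ a b → a := (b :+ a) :- b) refl (fib (suc n)) (fib (suc (suc n)))

-- Piecewise linear interpolation between the integers

slope : ℤ → ℚ
slope i = negaFib (ℤ.suc i) ℚ.- negaFib i

-- Bounds the slope at i and changes by at most a factor 2 between neighbours,
-- which makes the Lipschitz constant locally bounded.
size : ℤ → ℚ
size i = ∣ negaFib i ∣ ℚ.+ ∣ negaFib (ℤ.suc i) ∣

-- The line through (k, a) and (k + 1, b). Abstract knot and end values let the ring solver treat
-- them as variables.
segment : ℚ → ℚ → ℚ → ℚ → ℚ
segment k a b q = a ℚ.+ (q ℚ.- k) ℚ.* (b ℚ.- a)

piece : ℤ → ℚ → ℚ
piece i = segment (fromℤ i) (negaFib i) (negaFib (ℤ.suc i))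

interpolate : ℚ → ℚ
interpolate q = piece (floor q) q

-- All three arguments have the same offset `q - k` from their left knots, so the recurrences at the
-- two end values combine linearly.
segment-rec : ∀ k a b q {k′ k″ c d} → k′ ≡ 1ℚ ℚ.+ k → k″ ≡ 1ℚ ℚ.+ k′ →
  c ≡ a ℚ.- b → d ≡ b ℚ.- c →
  segment k″ c d ((q ℚ.+ 1ℚ) ℚ.+ 1ℚ) ≡ segment k a b q ℚ.- segment k′ b c (q ℚ.+ 1ℚ)
segment-rec k a b q refl refl refl refl = solve 4 (λ x k a b →
    (a :- b) :+ (((x :+ con 1ℚ) :+ con 1ℚ) :- (con 1ℚ :+ (con 1ℚ :+ k)))
                :* ((b :- (a :- b)) :- (a :- b))
    := (a :+ (x :- k) :* (b :- a))
       :- (b :+ ((x :+ con 1ℚ) :- (con 1ℚ :+ k)) :* ((a :- b) :- b)))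
  refl q k a b

interpolate-rec′ : ∀ q →
  interpolate ((q ℚ.+ 1ℚ) ℚ.+ 1ℚ) ≡ interpolate q ℚ.- interpolate (q ℚ.+ 1ℚ)
interpolate-rec′ q = begin
  interpolate (q ℚ.+ 1ℚ ℚ.+ 1ℚ)
    ≡⟨ cong (λ i → piece i (q ℚ.+ 1ℚ ℚ.+ 1ℚ)) (trans (floor-+1 (q ℚ.+ 1ℚ)) (cong ℤ.suc (floor-+1 q))) ⟩
  piece (ℤ.suc (ℤ.suc i)) (q ℚ.+ 1ℚ ℚ.+ 1ℚ)
    ≡⟨ segment-rec (fromℤ i) (negaFib i) (negaFib (ℤ.suc i)) q (fromℤ-+ (+ 1) i) (fromℤ-+ (+ 1) (ℤ.suc i))
         (negaFib-rec i) (negaFib-rec (ℤ.suc i)) ⟩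
  piece i q ℚ.- piece (ℤ.suc i) (q ℚ.+ 1ℚ)
    ≡⟨ cong (λ j → piece i q ℚ.- piece j (q ℚ.+ 1ℚ)) (floor-+1 q) ⟨
  interpolate q ℚ.- interpolate (q ℚ.+ 1ℚ) ∎
  where
  open ≡-Reasoning
  i = floor q

interpolate-rec : ∀ q →
  interpolate q ≡ interpolate (q ℚ.- 2ℚ) ℚ.- interpolate (q ℚ.- 1ℚ)
interpolate-rec q = begin
  interpolate q
    ≡⟨ cong interpolate (solve 1 (λ x → x := ((x :- con 2ℚ) :+ con 1ℚ) :+ con 1ℚ) refl q) ⟩
  interpolate ((q ℚ.- 2ℚ ℚ.+ 1ℚ) ℚ.+ 1ℚ)
    ≡⟨ interpolate-rec′ (q ℚ.- 2ℚ) ⟩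
  interpolate (q ℚ.- 2ℚ) ℚ.- interpolate (q ℚ.- 2ℚ ℚ.+ 1ℚ)
    ≡⟨ cong (λ x → interpolate (q ℚ.- 2ℚ) ℚ.- interpolate x)
            (solve 1 (λ x → (x :- con 2ℚ) :+ con 1ℚ := x :- con 1ℚ) refl q) ⟩
  interpolate (q ℚ.- 2ℚ) ℚ.- interpolate (q ℚ.- 1ℚ) ∎
  where open ≡-Reasoning

-- Local Lipschitz continuity of the interpolation

∣p-q∣≡∣q-p∣ : ∀ p q → ∣ p ℚ.- q ∣ ≡ ∣ q ℚ.- p ∣
∣p-q∣≡∣q-p∣ p q = trans
  (cong ∣_∣ (solve 2 (λ p q → p :- q := :- (q :- p)) refl p q))
  (ℚ.∣-p∣≡∣p∣ (q ℚ.- p))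

p≤p+∣q∣ : ∀ p q → p ℚ.≤ p ℚ.+ ∣ q ∣
p≤p+∣q∣ p q = subst (ℚ._≤ p ℚ.+ ∣ q ∣) (ℚ.+-identityʳ p) (ℚ.+-monoʳ-≤ p (ℚ.0≤∣p∣ q))

p≤∣p∣ : ∀ p → p ℚ.≤ ∣ p ∣
p≤∣p∣ p with ℚ.≤-total 0ℚ p
... | inj₁ 0≤p = ℚ.≤-reflexive (sym (ℚ.0≤p⇒∣p∣≡p 0≤p))
... | inj₂ p≤0 = ℚ.≤-trans p≤0 (ℚ.0≤∣p∣ p)

p≤q⇒0≤q-p : ∀ p q → p ℚ.≤ q → 0ℚ ℚ.≤ q ℚ.- p
p≤q⇒0≤q-p p q p≤q = subst (ℚ._≤ q ℚ.- p) (ℚ.+-inverseʳ p) (ℚ.+-monoˡ-≤ (ℚ.- p) p≤q)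

*-mono-≤-nonNeg : ∀ {p q r s} → 0ℚ ℚ.≤ p → 0ℚ ℚ.≤ s → p ℚ.≤ q → r ℚ.≤ s →
                  p ℚ.* r ℚ.≤ q ℚ.* s
*-mono-≤-nonNeg {p} {q} {r} {s} 0≤p 0≤s p≤q r≤s = ℚ.≤-trans
  (ℚ.*-monoˡ-≤-nonNeg p {{ℚ.nonNegative 0≤p}} r≤s)
  (ℚ.*-monoʳ-≤-nonNeg s {{ℚ.nonNegative 0≤s}} p≤q)

∣p*q∣≤ : ∀ p q {C} → 0ℚ ℚ.≤ p → ∣ q ∣ ℚ.≤ C → ∣ p ℚ.* q ∣ ℚ.≤ p ℚ.* C
∣p*q∣≤ p q {C} 0≤p q≤C = subst (ℚ._≤ p ℚ.* C)
  (sym (trans (ℚ.∣p*q∣≡∣p∣*∣q∣ p q) (cong (ℚ._* ∣ q ∣) (ℚ.0≤p⇒∣p∣≡p 0≤p))))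
  (ℚ.*-monoˡ-≤-nonNeg p {{ℚ.nonNegative 0≤p}} q≤C)

∣slope∣≤size : ∀ i → ∣ slope i ∣ ℚ.≤ size i
∣slope∣≤size i = ℚ.≤-trans (ℚ.∣p-q∣≤∣p∣+∣q∣ (negaFib (ℤ.suc i)) (negaFib i))
  (ℚ.≤-reflexive (ℚ.+-comm ∣ negaFib (ℤ.suc i) ∣ ∣ negaFib i ∣))

0≤size : ∀ i → 0ℚ ℚ.≤ size i
0≤size i = ℚ.≤-trans (ℚ.0≤∣p∣ (negaFib i)) (p≤p+∣q∣ ∣ negaFib i ∣ (negaFib (ℤ.suc i)))

size≤2*size : ∀ i → size i ℚ.≤ 2ℚ ℚ.* size i
size≤2*size i = subst₂ ℚ._≤_ (ℚ.+-identityʳ (size i))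
  (solve 1 (λ s → s :+ s := con 2ℚ :* s) refl (size i))
  (ℚ.+-monoʳ-≤ (size i) (0≤size i))

size-suc≤ : ∀ i → size (ℤ.suc i) ℚ.≤ 2ℚ ℚ.* size i
size-suc≤ i rewrite negaFib-rec i = begin
  ∣ b ∣ ℚ.+ ∣ a ℚ.- b ∣
    ≤⟨ ℚ.+-monoʳ-≤ ∣ b ∣ (ℚ.∣p-q∣≤∣p∣+∣q∣ a b) ⟩
  ∣ b ∣ ℚ.+ (∣ a ∣ ℚ.+ ∣ b ∣)
    ≤⟨ p≤p+∣q∣ _ a ⟩
  ∣ b ∣ ℚ.+ (∣ a ∣ ℚ.+ ∣ b ∣) ℚ.+ ∣ a ∣
    ≡⟨ solve 2 (λ x y → (y :+ (x :+ y)) :+ x := con 2ℚ :* (x :+ y)) refl ∣ a ∣ ∣ b ∣ ⟩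
  2ℚ ℚ.* (∣ a ∣ ℚ.+ ∣ b ∣) ∎
  where
  open ℚ.≤-Reasoning
  a = negaFib i
  b = negaFib (ℤ.suc i)

-- The recurrence read backwards, `a = b + c`, gives |a| + |b| ≤ 2|b| + |c|.
size≤size-suc : ∀ i → size i ℚ.≤ 2ℚ ℚ.* size (ℤ.suc i)
size≤size-suc i rewrite negaFib-rec i = begin
  ∣ a ∣ ℚ.+ ∣ b ∣
    ≡⟨ cong (λ x → ∣ x ∣ ℚ.+ ∣ b ∣) (solve 2 (λ a b → a := b :+ (a :- b)) refl a b) ⟩
  ∣ b ℚ.+ c ∣ ℚ.+ ∣ b ∣
    ≤⟨ ℚ.+-monoˡ-≤ ∣ b ∣ (ℚ.∣p+q∣≤∣p∣+∣q∣ b c) ⟩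
  ∣ b ∣ ℚ.+ ∣ c ∣ ℚ.+ ∣ b ∣
    ≤⟨ p≤p+∣q∣ _ c ⟩
  ∣ b ∣ ℚ.+ ∣ c ∣ ℚ.+ ∣ b ∣ ℚ.+ ∣ c ∣
    ≡⟨ solve 2 (λ x y → ((x :+ y) :+ x) :+ y := con 2ℚ :* (x :+ y)) refl ∣ b ∣ ∣ c ∣ ⟩
  2ℚ ℚ.* (∣ b ∣ ℚ.+ ∣ c ∣) ∎
  where
  open ℚ.≤-Reasoning
  a = negaFib i
  b = negaFib (ℤ.suc i)
  c = a ℚ.- b

size-near : ∀ i j → j ≡ i ⊎ j ≡ ℤ.suc i →
            size i ℚ.≤ 2ℚ ℚ.* size j × size j ℚ.≤ 2ℚ ℚ.* size i
size-near i _ (inj₁ refl) = size≤2*size i , size≤2*size i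
size-near i _ (inj₂ refl) = size≤size-suc i , size-suc≤ i

near⇒q≤p+1 : ∀ p q → ∣ p ℚ.- q ∣ ℚ.≤ 1ℚ → q ℚ.≤ p ℚ.+ 1ℚ
near⇒q≤p+1 p q near = subst (ℚ._≤ p ℚ.+ 1ℚ)
  (solve 2 (λ p q → p :+ (q :- p) := q) refl p q)
  (ℚ.+-monoʳ-≤ p (ℚ.≤-trans (p≤∣p∣ (q ℚ.- p)) (subst (ℚ._≤ 1ℚ) (∣p-q∣≡∣q-p∣ p q) near)))

size-floor-near : ∀ p q → ∣ p ℚ.- q ∣ ℚ.≤ 1ℚ →
                  size (floor p) ℚ.≤ 2ℚ ℚ.* size (floor q)
size-floor-near p q near with ℚ.≤-total p q
... | inj₁ p≤q = proj₁ (size-near (floor p) (floor q) (floor-step p≤q (near⇒q≤p+1 p q near)))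
... | inj₂ q≤p = proj₂ (size-near (floor q) (floor p) (floor-step q≤p (near⇒q≤p+1 q p (subst (ℚ._≤ 1ℚ) (∣p-q∣≡∣q-p∣ p q) near))))

-- Both segments take the value `b` at the common knot `k′`; each summand is the change between that
-- knot and one of the arguments.
segment-split : ∀ k a b c p q {k′} → k′ ≡ 1ℚ ℚ.+ k →
  segment k′ b c q ℚ.- segment k a b p ≡
  (q ℚ.- k′) ℚ.* (c ℚ.- b) ℚ.+ (k′ ℚ.- p) ℚ.* (b ℚ.- a)
segment-split k a b c p q refl = solve 6 (λ p q k a b d →
    (b :+ (q :- (con 1ℚ :+ k)) :* d) :- (a :+ (p :- k) :* (b :- a))
    := (q :- (con 1ℚ :+ k)) :* d :+ ((con 1ℚ :+ k) :- p) :* (b :- a))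
  refl p q k a b (c ℚ.- b)

-- On adjacent pieces the path from `p` to `q` is cut at the knot `j`; the lengths `q - j` and
-- `j - p` are nonnegative and add up to `q - p`.
piece-lipschitz : ∀ i j {p q C} → j ≡ i ⊎ j ≡ ℤ.suc i →
  p ℚ.≤ q → p ℚ.≤ fromℤ (ℤ.suc i) → fromℤ j ℚ.≤ q →
  ∣ slope i ∣ ℚ.≤ C → ∣ slope j ∣ ℚ.≤ C →
  ∣ piece j q ℚ.- piece i p ∣ ℚ.≤ (q ℚ.- p) ℚ.* C
piece-lipschitz i _ {p} {q} {C} (inj₁ refl) p≤q _ _ di≤C _ = subst (ℚ._≤ (q ℚ.- p) ℚ.* C)
  (cong ∣_∣ (solve 5 (λ p q k a d →
      (q :- p) :* d := (a :+ (q :- k) :* d) :- (a :+ (p :- k) :* d))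
    refl p q (fromℤ i) (negaFib i) (slope i)))
  (∣p*q∣≤ (q ℚ.- p) (slope i) (p≤q⇒0≤q-p p q p≤q) di≤C)
piece-lipschitz i j {p} {q} {C} (inj₂ refl) _ p≤j j≤q di≤C dj≤C = begin
  ∣ piece j q ℚ.- piece i p ∣
    ≡⟨ cong ∣_∣ (segment-split (fromℤ i) (negaFib i) (negaFib j) (negaFib (ℤ.suc j)) p q
          (fromℤ-+ (+ 1) i)) ⟩
  ∣ (q ℚ.- fromℤ j) ℚ.* slope j ℚ.+ (fromℤ j ℚ.- p) ℚ.* slope i ∣
    ≤⟨ ℚ.∣p+q∣≤∣p∣+∣q∣ ((q ℚ.- fromℤ j) ℚ.* slope j) ((fromℤ j ℚ.- p) ℚ.* slope i) ⟩
  ∣ (q ℚ.- fromℤ j) ℚ.* slope j ∣ ℚ.+ ∣ (fromℤ j ℚ.- p) ℚ.* slope i ∣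
    ≤⟨ ℚ.+-mono-≤ (∣p*q∣≤ (q ℚ.- fromℤ j) (slope j) (p≤q⇒0≤q-p (fromℤ j) q j≤q) dj≤C) (∣p*q∣≤ (fromℤ j ℚ.- p) (slope i) (p≤q⇒0≤q-p p (fromℤ j) p≤j) di≤C) ⟩
  (q ℚ.- fromℤ j) ℚ.* C ℚ.+ (fromℤ j ℚ.- p) ℚ.* C
    ≡⟨ solve 4 (λ p q k C → (q :- k) :* C :+ (k :- p) :* C := (q :- p) :* C)
         refl p q (fromℤ j) C ⟩
  (q ℚ.- p) ℚ.* C ∎
  where open ℚ.≤-Reasoning

interpolate-lipschitz-≤ : ∀ p q {C} → p ℚ.≤ q → q ℚ.≤ p ℚ.+ 1ℚ →
  ∣ slope (floor p) ∣ ℚ.≤ C → ∣ slope (floor q) ∣ ℚ.≤ C →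
  ∣ interpolate q ℚ.- interpolate p ∣ ℚ.≤ ∣ q ℚ.- p ∣ ℚ.* C
interpolate-lipschitz-≤ p q {C} p≤q q≤p+1 dp≤C dq≤C =
  subst (λ x → ∣ interpolate q ℚ.- interpolate p ∣ ℚ.≤ x ℚ.* C)
    (sym (ℚ.0≤p⇒∣p∣≡p (p≤q⇒0≤q-p p q p≤q)))
    (piece-lipschitz (floor p) (floor q) (floor-step p≤q q≤p+1)
      p≤q (ℚ.<⇒≤ (<-suc-floor p)) (floor-≤ q) dp≤C dq≤C)

-- The factor 2 pays for bounding the slope at `floor p` by the size at `floor q`, so the constant
-- depends on one point only.
interpolate-lipschitz : ∀ p q → ∣ p ℚ.- q ∣ ℚ.≤ 1ℚ →
  ∣ interpolate p ℚ.- interpolate q ∣ ℚ.≤ ∣ p ℚ.- q ∣ ℚ.* (2ℚ ℚ.* size (floor q))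
interpolate-lipschitz p q near with ℚ.≤-total p q
... | inj₁ p≤q = subst₂ (λ x y → x ℚ.≤ y ℚ.* (2ℚ ℚ.* size (floor q)))
    (∣p-q∣≡∣q-p∣ (interpolate q) (interpolate p)) (∣p-q∣≡∣q-p∣ q p)
    (interpolate-lipschitz-≤ p q p≤q (near⇒q≤p+1 p q near)
      (ℚ.≤-trans (∣slope∣≤size (floor p)) (size-floor-near p q near))
      (ℚ.≤-trans (∣slope∣≤size (floor q)) (size≤2*size (floor q))))
... | inj₂ q≤p =
    interpolate-lipschitz-≤ q p q≤p (near⇒q≤p+1 q p (subst (ℚ._≤ 1ℚ) (∣p-q∣≡∣q-p∣ p q) near))
      (ℚ.≤-trans (∣slope∣≤size (floor q)) (size≤2*size (floor q)))
      (ℚ.≤-trans (∣slope∣≤size (floor p)) (size-floor-near p q near))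

-- Sequences of rationals with the same limit

-- Close s s is IsCauchy s, and between Cauchy sequences closeness is _≈ᴿ_, so a
-- single preservation lemma yields both the Cauchy property and congruence.
Close : (ℕ → ℚ) → (ℕ → ℚ) → Set
Close s t = ∀ ε → 0ℚ ℚ.< ε →
  ∃ λ N → ∀ m n → N ℕ.≤ m → N ℕ.≤ n → ∣ s m ℚ.- t n ∣ ℚ.< ε

-- Opaque, since the with-abstractions over shrink would otherwise unfold it at great cost.
opaque
  shrink : ∀ C → 0ℚ ℚ.≤ C → ∀ ε → 0ℚ ℚ.< ε →
           ∃ λ δ → 0ℚ ℚ.< δ × C ℚ.* (δ ℚ.+ δ) ℚ.< ε
  shrink C 0≤C ε 0<ε = δ , 0<δ , (begin-strict
    C ℚ.* (δ ℚ.+ δ)              <⟨ ℚ.*-monoˡ-<-pos (δ ℚ.+ δ) {{ℚ.positive (ℚ.+-mono-< 0<δ 0<δ)}} C<D ⟩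
    D ℚ.* (δ ℚ.+ δ)              ≡⟨ solve 3 (λ d i e → d :* (con ½ :* (i :* e) :+ con ½ :* (i :* e)) := (i :* d) :* e) refl D D⁻¹ ε ⟩
    (D⁻¹ ℚ.* D) ℚ.* ε            ≡⟨ cong (ℚ._* ε) (ℚ.*-inverseˡ D) ⟩
    1ℚ ℚ.* ε                     ≡⟨ ℚ.*-identityˡ ε ⟩
    ε                            ∎)
    where
    open ℚ.≤-Reasoning
    D D⁻¹ δ : ℚ
    -- Adding 1 gives an invertible constant even for `C = 0`, and makes the final inequality
    -- strict.
    D = C ℚ.+ 1ℚ
    instance
      D-positive : ℚ.Positive D
      D-positive = ℚ.nonNeg+pos⇒pos C {{ℚ.nonNegative 0≤C}} 1ℚ
      D-nonZero : ℚ.NonZero D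
      D-nonZero = ℚ.pos⇒nonZero D
      ε-positive : ℚ.Positive ε
      ε-positive = ℚ.positive 0<ε
    D⁻¹ = ℚ.1/ D
    δ = ½ ℚ.* (D⁻¹ ℚ.* ε)
    0<δ : 0ℚ ℚ.< δ
    0<δ = ℚ.positive⁻¹ δ {{ℚ.pos*pos⇒pos ½ (D⁻¹ ℚ.* ε)
      {{ℚ.pos*pos⇒pos D⁻¹ {{ℚ.1/pos⇒pos D}} ε}}}}
    C<D : C ℚ.< D
    C<D = subst (ℚ._< D) (ℚ.+-identityʳ C) (ℚ.+-monoʳ-< C (ℚ.positive⁻¹ 1ℚ))

-- The common pattern behind sums, products and interpolation. The index `N` admits constants that
-- are valid only on a tail.
close-dominated : ∀ s t u v f g → Close s t → Close u v → ∀ C → 0ℚ ℚ.≤ C → ∀ N →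
  (∀ m n → N ℕ.≤ m → N ℕ.≤ n →
    ∣ f m ℚ.- g n ∣ ℚ.≤ C ℚ.* (∣ s m ℚ.- t n ∣ ℚ.+ ∣ u m ℚ.- v n ∣)) →
  Close f g
close-dominated s t u v f g s~t u~v C 0≤C N dominated ε 0<ε with shrink C 0≤C ε 0<ε
... | δ , 0<δ , Cδ<ε with s~t δ 0<δ | u~v δ 0<δ
... | K , closeK | L , closeL = (K ℕ.⊔ L) ℕ.⊔ N , bound
  where
  bound : ∀ m n → (K ℕ.⊔ L) ℕ.⊔ N ℕ.≤ m → (K ℕ.⊔ L) ℕ.⊔ N ℕ.≤ n → ∣ f m ℚ.- g n ∣ ℚ.< ε
  bound m n ≤m ≤n = begin-strict
    ∣ f m ℚ.- g n ∣
      ≤⟨ dominated m n (ℕ.m⊔n≤o⇒n≤o (K ℕ.⊔ L) N ≤m) (ℕ.m⊔n≤o⇒n≤o (K ℕ.⊔ L) N ≤n) ⟩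
    C ℚ.* (x ℚ.+ y)
      ≤⟨ ℚ.*-monoˡ-≤-nonNeg C {{ℚ.nonNegative 0≤C}} {x ℚ.+ y} {δ ℚ.+ δ}
           (ℚ.<⇒≤ (ℚ.+-mono-< {x} {δ} {y} {δ} x<δ y<δ)) ⟩
    C ℚ.* (δ ℚ.+ δ)
      <⟨ Cδ<ε ⟩
    ε ∎
    where
    open ℚ.≤-Reasoning
    KL≤m = ℕ.m⊔n≤o⇒m≤o (K ℕ.⊔ L) N ≤m
    KL≤n = ℕ.m⊔n≤o⇒m≤o (K ℕ.⊔ L) N ≤n
    x = ∣ s m ℚ.- t n ∣
    y = ∣ u m ℚ.- v n ∣
    x<δ : x ℚ.< δ
    x<δ = closeK m n (ℕ.m⊔n≤o⇒m≤o K L KL≤m) (ℕ.m⊔n≤o⇒m≤o K L KL≤n)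
    y<δ : y ℚ.< δ
    y<δ = closeL m n (ℕ.m⊔n≤o⇒n≤o K L KL≤m) (ℕ.m⊔n≤o⇒n≤o K L KL≤n)

close-+ : ∀ s t u v → Close s t → Close u v →
          Close (λ n → s n ℚ.+ u n) (λ n → t n ℚ.+ v n)
close-+ s t u v s~t u~v =
  close-dominated s t u v (λ n → s n ℚ.+ u n) (λ n → t n ℚ.+ v n) s~t u~v 1ℚ (ℚ.nonNegative⁻¹ 1ℚ) 0 λ m n _ _ → subst₂ ℚ._≤_
    (cong ∣_∣ (solve 4 (λ a b c d → (a :- b) :+ (c :- d) := (a :+ c) :- (b :+ d)) refl
       (s m) (t n) (u m) (v n)))
    (sym (ℚ.*-identityˡ (∣ s m ℚ.- t n ∣ ℚ.+ ∣ u m ℚ.- v n ∣)))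
    (ℚ.∣p+q∣≤∣p∣+∣q∣ (s m ℚ.- t n) (u m ℚ.- v n))

close-* : ∀ s t u v → Close s t → Close u v →
          Close (λ n → s n ℚ.* u n) (λ n → t n ℚ.* v n)
close-* s t u v s~t u~v with s~t 1ℚ (ℚ.positive⁻¹ 1ℚ) | u~v 1ℚ (ℚ.positive⁻¹ 1ℚ)
... | M , closeM | N , closeN = close-dominated s t u v (λ n → s n ℚ.* u n) (λ n → t n ℚ.* v n) s~t u~v C 0≤C (M ℕ.⊔ N) λ m n ≤m ≤n →
  let
    x = s m ; y = u m ; x′ = t n ; y′ = v n
    ∣x∣≤C = ℚ.≤-trans
      (bound x (t M) (closeM m M (ℕ.m⊔n≤o⇒m≤o M N ≤m) ℕ.≤-refl))
      (p≤p+∣q∣ _ (u N))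
    ∣y′∣≤C = ℚ.≤-trans
      (bound y′ (u N) (subst (ℚ._< 1ℚ) (∣p-q∣≡∣q-p∣ (u N) y′)
        (closeN N n ℕ.≤-refl (ℕ.m⊔n≤o⇒n≤o M N ≤n))))
      (ℚ.≤-trans (p≤p+∣q∣ _ (t M)) (ℚ.≤-reflexive
        (solve 3 (λ a b c → (b :+ c) :+ a := (a :+ c) :+ b) refl ∣ t M ∣ ∣ u N ∣ 1ℚ)))
  in begin
  ∣ x ℚ.* y ℚ.- x′ ℚ.* y′ ∣
    ≡⟨ cong ∣_∣ (solve 4 (λ x y x′ y′ →
         x :* y :- x′ :* y′ := (x :- x′) :* y′ :+ x :* (y :- y′)) refl x y x′ y′) ⟩
  ∣ (x ℚ.- x′) ℚ.* y′ ℚ.+ x ℚ.* (y ℚ.- y′) ∣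
    ≤⟨ ℚ.∣p+q∣≤∣p∣+∣q∣ ((x ℚ.- x′) ℚ.* y′) (x ℚ.* (y ℚ.- y′)) ⟩
  ∣ (x ℚ.- x′) ℚ.* y′ ∣ ℚ.+ ∣ x ℚ.* (y ℚ.- y′) ∣
    ≡⟨ cong₂ ℚ._+_ (ℚ.∣p*q∣≡∣p∣*∣q∣ (x ℚ.- x′) y′) (ℚ.∣p*q∣≡∣p∣*∣q∣ x (y ℚ.- y′)) ⟩
  ∣ x ℚ.- x′ ∣ ℚ.* ∣ y′ ∣ ℚ.+ ∣ x ∣ ℚ.* ∣ y ℚ.- y′ ∣
    ≤⟨ ℚ.+-mono-≤
         (ℚ.*-monoˡ-≤-nonNeg ∣ x ℚ.- x′ ∣ {{ℚ.∣-∣-nonNeg (x ℚ.- x′)}} ∣y′∣≤C)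
         (ℚ.*-monoʳ-≤-nonNeg ∣ y ℚ.- y′ ∣ {{ℚ.∣-∣-nonNeg (y ℚ.- y′)}} ∣x∣≤C) ⟩
  ∣ x ℚ.- x′ ∣ ℚ.* C ℚ.+ C ℚ.* ∣ y ℚ.- y′ ∣
    ≡⟨ solve 3 (λ a b c → a :* c :+ c :* b := c :* (a :+ b)) refl
         ∣ x ℚ.- x′ ∣ ∣ y ℚ.- y′ ∣ C ⟩
  C ℚ.* (∣ x ℚ.- x′ ∣ ℚ.+ ∣ y ℚ.- y′ ∣) ∎
  where
  open ℚ.≤-Reasoning
  -- On the tail `s m` lies within 1 of `t M`, and `v n` within 1 of `u N`; `C` bounds both factors
  -- at once.
  C = ∣ t M ∣ ℚ.+ 1ℚ ℚ.+ ∣ u N ∣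
  0≤C : 0ℚ ℚ.≤ C
  0≤C = ℚ.≤-trans (ℚ.0≤∣p∣ (t M)) (ℚ.≤-trans (p≤p+∣q∣ _ 1ℚ) (p≤p+∣q∣ _ (u N)))
  bound : ∀ p q → ∣ p ℚ.- q ∣ ℚ.< 1ℚ → ∣ p ∣ ℚ.≤ ∣ q ∣ ℚ.+ 1ℚ
  bound p q near = ℚ.≤-trans
    (subst (ℚ._≤ ∣ q ∣ ℚ.+ ∣ p ℚ.- q ∣)
      (cong ∣_∣ (solve 2 (λ p q → q :+ (p :- q) := p) refl p q))
      (ℚ.∣p+q∣≤∣p∣+∣q∣ q (p ℚ.- q)))
    (ℚ.+-monoʳ-≤ ∣ q ∣ (ℚ.<⇒≤ near))

-- Local Lipschitz bounds suffice: past `N` every `t n` is within 1 of the fixed point `s N`, and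
-- every `s m` is within 1 of `t n`.
close-interpolate : ∀ s t → Close s t →
                    Close (λ n → interpolate (s n)) (λ n → interpolate (t n))
close-interpolate s t s~t with s~t 1ℚ (ℚ.positive⁻¹ 1ℚ)
... | N , near = close-dominated s t s t (λ n → interpolate (s n)) (λ n → interpolate (t n)) s~t s~t C 0≤C N λ m n N≤m N≤n →
  let
    ∣∣ = ∣ s m ℚ.- t n ∣
    C-bound = ℚ.*-monoˡ-≤-nonNeg 2ℚ (size-floor-near (t n) (s N) (subst (ℚ._≤ 1ℚ)
      (∣p-q∣≡∣q-p∣ (s N) (t n)) (ℚ.<⇒≤ (near N n ℕ.≤-refl N≤n))))
  in begin
  ∣ interpolate (s m) ℚ.- interpolate (t n) ∣
    ≤⟨ interpolate-lipschitz (s m) (t n) (ℚ.<⇒≤ (near m n N≤m N≤n)) ⟩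
  ∣∣ ℚ.* (2ℚ ℚ.* size (floor (t n)))
    ≤⟨ *-mono-≤-nonNeg (ℚ.0≤∣p∣ (s m ℚ.- t n)) 0≤C (p≤p+∣q∣ ∣∣ (s m ℚ.- t n)) C-bound ⟩
  (∣∣ ℚ.+ ∣∣) ℚ.* C
    ≡⟨ ℚ.*-comm (∣∣ ℚ.+ ∣∣) C ⟩
  C ℚ.* (∣∣ ℚ.+ ∣∣) ∎
  where
  open ℚ.≤-Reasoning
  -- One factor 2 comes from `interpolate-lipschitz`, the other from moving the size from
  -- `floor (t n)` to `floor (s N)`.
  C = 2ℚ ℚ.* (2ℚ ℚ.* size (floor (s N)))
  0≤C : 0ℚ ℚ.≤ C
  0≤C = ℚ.*-monoˡ-≤-nonNeg 2ℚ (ℚ.*-monoˡ-≤-nonNeg 2ℚ (0≤size (floor (s N))))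

-- Since `_≈ᴿ_` compares equal indices only, the Cauchy property of `x` first moves the index from
-- `m` to `n`.
≈ᴿ⇒close : ∀ x y → x ≈ᴿ y → Close (seq x) (seq y)
≈ᴿ⇒close x y x≈y ε 0<ε with shrink 1ℚ (ℚ.nonNegative⁻¹ 1ℚ) ε 0<ε
... | δ , 0<δ , δ+δ<ε with x≈y δ 0<δ | cauchy x δ 0<δ
... | M , closeM | N , closeN = M ℕ.⊔ N , bound
  where
  bound : ∀ m n → M ℕ.⊔ N ℕ.≤ m → M ℕ.⊔ N ℕ.≤ n → ∣ seq x m ℚ.- seq y n ∣ ℚ.< ε
  bound m n ≤m ≤n = begin-strict
    ∣ seq x m ℚ.- seq y n ∣
      ≡⟨ cong ∣_∣ (solve 3 (λ a b c → a :- c := (a :- b) :+ (b :- c)) refl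
           (seq x m) (seq x n) (seq y n)) ⟩
    ∣ p ℚ.+ q ∣      ≤⟨ ℚ.∣p+q∣≤∣p∣+∣q∣ p q ⟩
    ∣ p ∣ ℚ.+ ∣ q ∣  <⟨ ℚ.+-mono-< {∣ p ∣} {δ} {∣ q ∣} {δ} p<δ q<δ ⟩
    δ ℚ.+ δ          ≡⟨ ℚ.*-identityˡ (δ ℚ.+ δ) ⟨
    1ℚ ℚ.* (δ ℚ.+ δ) <⟨ δ+δ<ε ⟩
    ε                ∎
    where
    open ℚ.≤-Reasoning
    p = seq x m ℚ.- seq x n
    q = seq x n ℚ.- seq y n
    p<δ : ∣ p ∣ ℚ.< δ
    p<δ = closeN m n (ℕ.m⊔n≤o⇒n≤o M N ≤m) (ℕ.m⊔n≤o⇒n≤o M N ≤n)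
    q<δ : ∣ q ∣ ℚ.< δ
    q<δ = closeM n (ℕ.m⊔n≤o⇒m≤o M N ≤n)

close⇒≈ᴿ : ∀ x y → Close (seq x) (seq y) → x ≈ᴿ y
close⇒≈ᴿ x y x~y ε 0<ε = proj₁ (x~y ε 0<ε) , λ n N≤n → proj₂ (x~y ε 0<ε) n n N≤n N≤n

≗⇒≈ᴿ : ∀ x y → (∀ n → seq x n ≡ seq y n) → x ≈ᴿ y
≗⇒≈ᴿ x y x≗y ε 0<ε = 0 , λ n _ →
  subst (λ a → ∣ seq x n ℚ.- a ∣ ℚ.< ε) (x≗y n) (proj₂ (≈ᴿ-refl {x} ε 0<ε) n ℕ.z≤n)

-- The extension of a natural sequence

extendSeq : (ℕ → ℚ) → (ℕ → ℚ) → (ℕ → ℚ) → ℕ → ℚ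
extendSeq u v s n =
  interpolate (s n ℚ.- 2ℚ) ℚ.* u n ℚ.+ interpolate (s n ℚ.- 1ℚ) ℚ.* v n

-- With `s = t` this makes `extendᴿ` a real number; with two representatives of one real it gives
-- congruence.
close-extendSeq : ∀ u v s t → Close u u → Close v v → Close s t →
                  Close (extendSeq u v s) (extendSeq u v t)
close-extendSeq u v s t u~u v~v s~t = close-+
  (λ n → interpolate (s n ℚ.- 2ℚ) ℚ.* u n) (λ n → interpolate (t n ℚ.- 2ℚ) ℚ.* u n)
  (λ n → interpolate (s n ℚ.- 1ℚ) ℚ.* v n) (λ n → interpolate (t n ℚ.- 1ℚ) ℚ.* v n)
  (term 2ℚ u u~u) (term 1ℚ v v~v)
  where
  term : ∀ q w → Close w w →
         Close (λ n → interpolate (s n ℚ.- q) ℚ.* w n) (λ n → interpolate (t n ℚ.- q) ℚ.* w n)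
  term q w w~w = close-*
    (λ n → interpolate (s n ℚ.- q)) (λ n → interpolate (t n ℚ.- q)) w w
    (close-interpolate (λ n → s n ℚ.- q) (λ n → t n ℚ.- q)
      (close-+ s t (λ _ → ℚ.- q) (λ _ → ℚ.- q) s~t (cauchy (fromℚᴿ (ℚ.- q)))))
    w~w

extendᴿ : ℝ → ℝ → ℝ → ℝ
extendᴿ u v x = mkℝ (extendSeq (seq u) (seq v) (seq x))
  (close-extendSeq (seq u) (seq v) (seq x) (seq x) (cauchy u) (cauchy v) (cauchy x))

extendᴿ-cong : ∀ u v {x y} → x ≈ᴿ y → extendᴿ u v x ≈ᴿ extendᴿ u v y
extendᴿ-cong u v {x} {y} x≈y = close⇒≈ᴿ (extendᴿ u v x) (extendᴿ u v y)
  (close-extendSeq (seq u) (seq v) (seq x) (seq y) (cauchy u) (cauchy v) (≈ᴿ⇒close x y x≈y))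

-- The equation already holds term by term on representatives. `swap` is needed because the two
-- sides subtract 1 and 2 in opposite orders.
extendᴿ-rec : ∀ u v x → extendᴿ u v x ≈ᴿ
  extendᴿ u v (x -ᴿ fromℚᴿ 2ℚ) -ᴿ extendᴿ u v (x -ᴿ fromℚᴿ 1ℚ)
extendᴿ-rec u v x = ≗⇒≈ᴿ (extendᴿ u v x)
  (extendᴿ u v (x -ᴿ fromℚᴿ 2ℚ) -ᴿ extendᴿ u v (x -ᴿ fromℚᴿ 1ℚ)) λ n → begin
    I (seq x n ℚ.- 2ℚ) ℚ.* seq u n ℚ.+ I (seq x n ℚ.- 1ℚ) ℚ.* seq v n
      ≡⟨ cong₂ (λ a b → a ℚ.* seq u n ℚ.+ b ℚ.* seq v n)
           (trans (interpolate-rec (seq x n ℚ.- 2ℚ))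
             (cong (λ a → I (seq x n ℚ.- 2ℚ ℚ.- 2ℚ) ℚ.- I a) (swap (seq x n))))
           (trans (interpolate-rec (seq x n ℚ.- 1ℚ))
             (cong (λ a → I a ℚ.- I (seq x n ℚ.- 1ℚ ℚ.- 1ℚ)) (sym (swap (seq x n))))) ⟩
    (I (seq x n ℚ.- 2ℚ ℚ.- 2ℚ) ℚ.- I (seq x n ℚ.- 1ℚ ℚ.- 2ℚ)) ℚ.* seq u n ℚ.+
    (I (seq x n ℚ.- 2ℚ ℚ.- 1ℚ) ℚ.- I (seq x n ℚ.- 1ℚ ℚ.- 1ℚ)) ℚ.* seq v n
      ≡⟨ solve 6 (λ a b c d u v → (a :- b) :* u :+ (c :- d) :* v
                   := (a :* u :+ c :* v) :- (b :* u :+ d :* v)) refl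
           (I (seq x n ℚ.- 2ℚ ℚ.- 2ℚ)) (I (seq x n ℚ.- 1ℚ ℚ.- 2ℚ))
           (I (seq x n ℚ.- 2ℚ ℚ.- 1ℚ)) (I (seq x n ℚ.- 1ℚ ℚ.- 1ℚ))
           (seq u n) (seq v n) ⟩
    _ ∎
  where
  open ≡-Reasoning
  I = interpolate
  swap : ∀ q → q ℚ.- 2ℚ ℚ.- 1ℚ ≡ q ℚ.- 1ℚ ℚ.- 2ℚ
  swap = solve 1 (λ q → (q :- con 2ℚ) :- con 1ℚ := (q :- con 1ℚ) :- con 2ℚ) refl

-- The coefficients are `interpolate` at -1 and 0, closed terms that evaluate to 1 and 0.
extendᴿ-at-1 : ∀ u v → extendᴿ u v (fromℚᴿ 1ℚ) ≈ᴿ u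
extendᴿ-at-1 u v = ≗⇒≈ᴿ (extendᴿ u v (fromℚᴿ 1ℚ)) u λ n →
  solve 2 (λ a b → con 1ℚ :* a :+ con 0ℚ :* b := a) refl (seq u n) (seq v n)

extendᴿ-at-2 : ∀ u v → extendᴿ u v (fromℚᴿ 2ℚ) ≈ᴿ v
extendᴿ-at-2 u v = ≗⇒≈ᴿ (extendᴿ u v (fromℚᴿ 2ℚ)) v λ n →
  solve 2 (λ a b → con 0ℚ :* a :+ con 1ℚ :* b := b) refl (seq u n) (seq v n)

extend : ℂ → ℂ → ComplexFunction
extend a b = record
  { to   = λ z → extendᴿ (re a) (re b) (re z) +i extendᴿ (im a) (im b) (re z)
  ; cong = λ {w} {z} (p , _) →
      extendᴿ-cong (re a) (re b) {re w} {re z} p ,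
      extendᴿ-cong (im a) (im b) {re w} {re z} p
  }

-- The real parts of `fromℕ 2` and `fromℕ 1` evaluate to the constants `2ℚ` and `1ℚ`, so the real
-- recurrence applies to each component.
extend-complete : ∀ a b → IsComplexCompleteNFe (extend a b)
extend-complete a b z =
  extendᴿ-rec (re a) (re b) (re z) , extendᴿ-rec (im a) (im b) (re z)

-- Restriction to the natural numbers

+ᴿ-cong : ∀ {x x′ y y′} → x ≈ᴿ x′ → y ≈ᴿ y′ → x +ᴿ y ≈ᴿ x′ +ᴿ y′
+ᴿ-cong {x} {x′} {y} {y′} p q = close⇒≈ᴿ (x +ᴿ y) (x′ +ᴿ y′)
  (close-+ (seq x) (seq x′) (seq y) (seq y′) (≈ᴿ⇒close x x′ p) (≈ᴿ⇒close y y′ q))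

-ᴿ-cong : ∀ {x y} → x ≈ᴿ y → -ᴿ x ≈ᴿ -ᴿ y
-ᴿ-cong {x} {y} x≈y ε 0<ε = proj₁ (x≈y ε 0<ε) , λ n N≤n → subst (ℚ._< ε)
  (trans (sym (ℚ.∣-p∣≡∣p∣ (seq x n ℚ.- seq y n)))
    (cong ∣_∣ (ℚ.neg-distrib-+ (seq x n) (ℚ.- seq y n))))
  (proj₂ (x≈y ε 0<ε) n N≤n)

-‿cong : ∀ {w w′ z z′} → w ≈ w′ → z ≈ z′ → w - z ≈ w′ - z′
-‿cong {w} {w′} {z} {z′} (p , p′) (q , q′) =
  +ᴿ-cong {re w} {re w′} { -ᴿ re z} { -ᴿ re z′} p (-ᴿ-cong {re z} {re z′} q) ,
  +ᴿ-cong {im w} {im w′} { -ᴿ im z} { -ᴿ im z′} p′ (-ᴿ-cong {im z} {im z′} q′)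

fromℕ-∸ : ∀ k n → fromℕ (k ℕ.+ n) - fromℕ k ≈ fromℕ n
fromℕ-∸ k n =
  ≗⇒≈ᴿ (re (fromℕ (k ℕ.+ n) - fromℕ k)) (re (fromℕ n)) (λ _ → eq) ,
  ≗⇒≈ᴿ (im (fromℕ (k ℕ.+ n) - fromℕ k)) (im (fromℕ n)) (λ _ → refl)
  where
  eq : + (k ℕ.+ n) ℚ./ 1 ℚ.- + k ℚ./ 1 ≡ + n ℚ./ 1
  -- The division by 1 normalises by a gcd, which is stuck on variables; rewriting to `fromℤ`
  -- exposes a ring identity.
  eq rewrite ℚ.↥p/↧p≡p (fromℤ (+ (k ℕ.+ n))) | ℚ.↥p/↧p≡p (fromℤ (+ k))
           | ℚ.↥p/↧p≡p (fromℤ (+ n)) | fromℤ-+ (+ k) (+ n)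
    = solve 2 (λ k n → (k :+ n) :- k := n) refl (fromℤ (+ k)) (fromℤ (+ n))

restrict : ComplexFunction → NatSequence
restrict ω̃ n = ω̃ ⟨$⟩ fromℕ n

-- The shifted arguments equal the smaller naturals only up to `_≈_`, so this rests on `ω̃`
-- respecting that equality.
restrict-isNatural : ∀ ω̃ → IsComplexCompleteNFe ω̃ → IsNaturalCompleteNFe (restrict ω̃)
restrict-isNatural ω̃ complete n = begin
  ω̃ ⟨$⟩ fromℕ (3 ℕ.+ n)
    ≈⟨ complete (fromℕ (3 ℕ.+ n)) ⟩
  ω̃ ⟨$⟩ (fromℕ (3 ℕ.+ n) - fromℕ 2) - ω̃ ⟨$⟩ (fromℕ (3 ℕ.+ n) - fromℕ 1)
    ≈⟨ -‿cong {ω̃ ⟨$⟩ (fromℕ (3 ℕ.+ n) - fromℕ 2)} {ω̃ ⟨$⟩ fromℕ (1 ℕ.+ n)}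
              {ω̃ ⟨$⟩ (fromℕ (3 ℕ.+ n) - fromℕ 1)} {ω̃ ⟨$⟩ fromℕ (2 ℕ.+ n)}
         (Func.cong ω̃ (fromℕ-∸ 2 (1 ℕ.+ n))) (Func.cong ω̃ (fromℕ-∸ 1 (2 ℕ.+ n))) ⟩
  ω̃ ⟨$⟩ fromℕ (1 ℕ.+ n) - ω̃ ⟨$⟩ fromℕ (2 ℕ.+ n) ∎
  where open ≈-Reasoning ℂ-setoid

nFe-unique : ∀ {ω ω′} → IsNaturalCompleteNFe ω → IsNaturalCompleteNFe ω′ →
             ω 1 ≈ ω′ 1 → ω 2 ≈ ω′ 2 → ω ≐ ω′
nFe-unique {ω} {ω′} rec rec′ eq₁ eq₂ (suc n) = proj₁ (pairs n)
  where
  -- The recurrence has order two, so the induction carries two consecutive values.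
  pairs : ∀ n → ω (1 ℕ.+ n) ≈ ω′ (1 ℕ.+ n) × ω (2 ℕ.+ n) ≈ ω′ (2 ℕ.+ n)
  pairs zero = eq₁ , eq₂
  pairs (suc n) with pairs n
  ... | p , q = q , (begin
    ω (3 ℕ.+ n)                     ≈⟨ rec n ⟩
    ω (1 ℕ.+ n) - ω (2 ℕ.+ n)       ≈⟨ -‿cong {ω (1 ℕ.+ n)} {ω′ (1 ℕ.+ n)} {ω (2 ℕ.+ n)} {ω′ (2 ℕ.+ n)} p q ⟩
    ω′ (1 ℕ.+ n) - ω′ (2 ℕ.+ n)     ≈⟨ rec′ n ⟨
    ω′ (3 ℕ.+ n)                    ∎)
    where open ≈-Reasoning ℂ-setoid

-- The restricted extension is itself a natural sequence, so agreement at 1 and 2 propagates by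
-- `nFe-unique`.
extend-corresponds : ∀ ω → IsNaturalCompleteNFe ω → IsCorrespondingNFe ω (extend (ω 1) (ω 2))
extend-corresponds ω natural = natural ,
  nFe-unique {restrict ω̃} {ω} (restrict-isNatural ω̃ (extend-complete (ω 1) (ω 2))) natural
    (extendᴿ-at-1 (re (ω 1)) (re (ω 2)) , extendᴿ-at-1 (im (ω 1)) (im (ω 2)))
    (extendᴿ-at-2 (re (ω 1)) (re (ω 2)) , extendᴿ-at-2 (im (ω 1)) (im (ω 2)))
  where ω̃ = extend (ω 1) (ω 2)

theorem3p5 : (∀ (ω : NatSequence) → IsNaturalCompleteNFe ω →
    ∃ λ (ω̃ : ComplexFunction) → IsComplexCompleteNFe ω̃ × IsCorrespondingNFe ω ω̃)
    ×
    (∀ (ω̃ : ComplexFunction) → IsComplexCompleteNFe ω̃ →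
    ∃! _≐_ λ (ω : NatSequence) → IsCorrespondingNFe ω ω̃)
theorem3p5 =
  (λ ω natural → extend (ω 1) (ω 2) , extend-complete (ω 1) (ω 2) , extend-corresponds ω natural) ,
  (λ ω̃ complete → restrict ω̃ ,
    (restrict-isNatural ω̃ complete , λ n → Setoid.refl ℂ-setoid {restrict ω̃ n}) ,
    -- Correspondence fixes every value: `agree n` is literally `restrict ω̃ n ≈ ω n`.
    λ (_ , agree) n → agree n)
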